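{- For all positive integers $m$ and $k$, the Kneser graph $\mathrm{KG}(m(2k+1),mk)$ (whose odd girth is $2k+1$) admits an orientation in which every cycle of length $2k+1$ is alternating.
   Context: The Kneser graph $\mathrm{KG}(n,k)$ ($n\ge 2k$) has as vertices all $k$-element subsets of $\{1,\dots,n\}$, two being adjacent iff disjoint. The odd girth is the length of a shortest odd cycle. An orientation assigns each edge exactly one direction. In an oriented graph, a subgraph that is a cycle is called alternating if at most one of its vertices has both positive in-degree and positive out-degree within that cycle. -}

module Defs where

open import Data.Fin using (Fin; toℕ)
open import Data.Fin.Subset using (Subset; ∣_∣; _∩_; Empty)
open import Data.Fin.Subset.Properties using (∩-comm; ∩-idem; Empty-unique; ∣⊥∣≡0)
open import Data.List using (length; filter; allFin)
open import Data.Nat using (ℕ; suc; _≤_; _<_; NonZero; ≢-nonZero⁻¹)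
open import Data.Nat.Divisibility using (_∤_)
open import Data.Nat.Properties using (_≟_)
open import Data.Product using (Σ; _×_; _,_; proj₁)
open import Data.Sum using (_⊎_)
open import Function.Definitions using (Injective)
open import Level using (0ℓ)
open import Relation.Binary.Core using (Rel)
open import Relation.Binary.Definitions using (Symmetric; Irreflexive; Asymmetric; Decidable)
open import Relation.Binary.PropositionalEquality using (_≡_; refl; sym; trans; cong; subst)
open import Relation.Nullary.Decidable using (_×-dec_; _⊎-dec_)

record SimpleGraph : Set₁ where
  infix 4 _~_
  field
    Vertex   : Set
    _~_      : Rel Vertex 0ℓ
    ~-sym    : Symmetric _~_
    ~-irrefl : Irreflexive _≡_ _~_

-- The ground set {1,…,n} is Fin n.  k ≥ 1 is needed for irreflexivity, since
-- the empty set is disjoint from itself.  The usual convention n ≥ 2k is not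
-- imposed: for n < 2k the graph simply has no edges.
KG : (n k : ℕ) → .{{NonZero k}} → SimpleGraph
KG n k = record
  { Vertex   = Σ (Subset n) λ p → ∣ p ∣ ≡ k
  ; _~_      = λ u v → Empty (proj₁ u ∩ proj₁ v)
  ; ~-sym    = λ {u} {v} → subst Empty (∩-comm (proj₁ u) (proj₁ v))
  ; ~-irrefl = λ { {p , ∣p∣≡k} refl p∩p=∅ → ≢-nonZero⁻¹ k
      (trans (sym ∣p∣≡k)
        (trans (cong ∣_∣ (Empty-unique (subst Empty (∩-idem p) p∩p=∅))) (∣⊥∣≡0 n))) }
  }

-- j is the cyclic successor of i in ℤ/ℓ.
Next : ∀ {ℓ} → Rel (Fin ℓ) 0ℓ
Next {ℓ} i j = (toℕ j ≡ suc (toℕ i)) ⊎ (suc (toℕ i) ≡ ℓ × toℕ j ≡ 0)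

CyclicallyAdjacent : ∀ {ℓ} → Rel (Fin ℓ) 0ℓ
CyclicallyAdjacent i j = Next i j ⊎ Next j i

next? : ∀ {ℓ} → Decidable (Next {ℓ})
next? {ℓ} i j = (toℕ j ≟ suc (toℕ i)) ⊎-dec ((suc (toℕ i) ≟ ℓ) ×-dec (toℕ j ≟ 0))

cyclicallyAdjacent? : ∀ {ℓ} → Decidable (CyclicallyAdjacent {ℓ})
cyclicallyAdjacent? i j = next? i j ⊎-dec next? j i

module _ (G : SimpleGraph) where
  open SimpleGraph G

  -- A cycle subgraph together with a cyclic enumeration of its vertices; its
  -- edges are exactly the pairs at cyclically adjacent positions.
  record Cycle (ℓ : ℕ) : Set where
    field
      3≤ℓ              : 3 ≤ ℓ
      vertex           : Fin ℓ → Vertex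
      vertex-injective : Injective _≡_ _≡_ vertex
      edge             : ∀ {i j} → Next i j → vertex i ~ vertex j

  HasOddGirth : ℕ → Set
  HasOddGirth g = 2 ∤ g × Cycle g × (∀ ℓ → 2 ∤ ℓ → Cycle ℓ → g ≤ ℓ)

  -- Decidability of arcs makes degrees computable as numbers.
  record Orientation : Set₁ where
    infix 4 _⇒_ _⇒?_
    field
      _⇒_      : Rel Vertex 0ℓ
      _⇒?_     : Decidable _⇒_
      arc⇒edge : ∀ {u v} → u ⇒ v → u ~ v
      edge⇒arc : ∀ {u v} → u ~ v → u ⇒ v ⊎ v ⇒ u
      ⇒-asym   : Asymmetric _⇒_

module _ {G : SimpleGraph} (O : Orientation G) {ℓ : ℕ} (C : Cycle G ℓ) where
  open Orientation O
  open Cycle C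

  -- Degrees within the cycle, of the vertex at position i.
  inDegree outDegree : Fin ℓ → ℕ
  inDegree i = length (filter (λ j → cyclicallyAdjacent? i j ×-dec (vertex j ⇒? vertex i)) (allFin ℓ))
  outDegree i = length (filter (λ j → cyclicallyAdjacent? i j ×-dec (vertex i ⇒? vertex j)) (allFin ℓ))

  Alternating : Set
  Alternating = ∀ i j → 0 < inDegree i × 0 < outDegree i → 0 < inDegree j × 0 < outDegree j → i ≡ j

{-# OPTIONS --safe #-}

-- Let A₀, …, A_{2r} be an odd cycle in the Kneser graph.  The positions i with
-- x ∈ Aᵢ form an independent set of the cycle, so each element x lies in at most
-- r of the sets.  Double counting gives k ≤ r, hence the odd girth; when r = k it
-- shows moreover that x lies in exactly k of the sets, so that exactly one edge
-- of the cycle avoids x.  Orient every edge from its lexicographically larger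
-- end.  An end containing the first element is then a source, so a vertex with
-- arcs both in and out is the tail of the unique edge avoiding that element.
module Submission where

open import Defs
open import Algebra.Properties.CommutativeMonoid.Sum using (sum; sum-cong-≗; sum-init-last; ∑-distrib-+; ∑-comm)
open import Data.Bool using (Bool; true; false; not; _∧_; _∨_)
import Data.Bool as Bool
import Data.Bool.Properties as Bool
open import Data.Fin using (Fin; zero; suc; toℕ; fromℕ; inject₁; lower₁; combine)
open import Data.Fin.Properties using (toℕ-injective; toℕ-fromℕ; toℕ-inject₁; toℕ-lower₁; toℕ<n; toℕ≤pred[n]; combine-surjective)
open import Data.Fin.Subset using (Subset; ∣_∣; _∩_; Empty)
open import Data.Fin.Subset.Properties using (nonempty?)
open import Data.List using (_∷_; length; filter; allFin)
open import Data.Nat using (ℕ; zero; suc; _+_; _*_; _≤_; _<_; z≤n; s≤s; NonZero; ≢-nonZero⁻¹; _≟_)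
open import Data.Nat.Divisibility using (_∤_; divides; ∣m+n∣m⇒∣n; ∣m∣n⇒∣m+n; ∣-refl; m∣m*n; ∣⇒≤)
open import Data.Nat.Properties hiding (_≟_; <-asym; <-cmp)
open import Data.Nat.Tactic.RingSolver using (solve-∀)
open import Data.Product using (Σ; ∃; _×_; _,_; proj₁; proj₂)
open import Data.Sum using (_⊎_; inj₁; inj₂)
open import Data.Vec using (_∷_; []; _++_; lookup; tabulate; concat; replicate)
open import Data.Vec.Properties using ([]=⇒lookup; lookup⇒[]=; lookup-zipWith; lookup∘tabulate; lookup-concat; lookup-replicate; ++-injectiveˡ)
open import Data.Vec.Relation.Binary.Lex.Strict using (Lex-<; this; next; <-asym; <-cmp; <-decidable)
open import Data.Vec.Relation.Binary.Pointwise.Inductive using (Pointwise-≡⇒≡)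
open import Function using (_∘_)
open import Relation.Binary.Definitions using (tri<; tri≈; tri>)
open import Relation.Binary.PropositionalEquality using (_≡_; _≢_; refl; sym; trans; cong; cong₂; module ≡-Reasoning)
open import Relation.Nullary using (yes; no; contradiction)
open import Relation.Nullary.Decidable using (_×-dec_; ¬?)
open import Relation.Unary using (Decidable)

private
  ∑ : ∀ {n} → (Fin n → ℕ) → ℕ
  ∑ = sum +-0-commutativeMonoid

-- Finite sums of natural numbers

∑-const : ∀ {n c} {t : Fin n → ℕ} → (∀ i → t i ≡ c) → ∑ t ≡ n * c
∑-const {zero}  t≡c = refl
∑-const {suc n} t≡c = cong₂ _+_ (t≡c zero) (∑-const (t≡c ∘ suc))

∑-bounded : ∀ {n c} {t : Fin n → ℕ} → (∀ i → t i ≤ c) → ∑ t ≤ n * c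
∑-bounded {zero}  t≤c = z≤n
∑-bounded {suc n} t≤c = +-mono-≤ (t≤c zero) (∑-bounded (t≤c ∘ suc))

-- The other `n` terms total at most `n * c`, so the first cannot fall short. Position `zero` will
-- be the first element of the ground set, the only one the orientation argument looks at.
∑-bounded-tight : ∀ {n c} {t : Fin (suc n) → ℕ} → (∀ i → t i ≤ c) → ∑ t ≡ suc n * c → t zero ≡ c
∑-bounded-tight {n} {c} {t} t≤c ∑t≡ = ≤-antisym (t≤c zero) (+-cancelʳ-≤ (n * c) c (t zero) (begin
  c + n * c               ≡⟨ ∑t≡ ⟨
  t zero + ∑ (t ∘ suc)    ≤⟨ +-monoʳ-≤ (t zero) (∑-bounded (t≤c ∘ suc)) ⟩
  t zero + n * c          ∎))
  where open ≤-Reasoning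

term≤∑ : ∀ {n} (t : Fin n → ℕ) i → t i ≤ ∑ t
term≤∑ t zero    = m≤m+n _ _
term≤∑ t (suc i) = ≤-trans (term≤∑ (t ∘ suc) i) (m≤n+m _ _)

∑≤1⇒unique : ∀ {n} (t : Fin n → ℕ) → ∑ t ≤ 1 → ∀ i j → t i ≡ 1 → t j ≡ 1 → i ≡ j
∑≤1⇒unique t ∑t≤1 zero zero ti tj = refl
∑≤1⇒unique t ∑t≤1 zero (suc j) ti tj = contradiction
  (≤-trans (+-mono-≤ (≤-reflexive (sym ti)) (≤-trans (≤-reflexive (sym tj)) (term≤∑ (t ∘ suc) j))) ∑t≤1)
  λ { (s≤s ()) }
∑≤1⇒unique t ∑t≤1 (suc i) zero ti tj = sym (∑≤1⇒unique t ∑t≤1 zero (suc i) tj ti)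
∑≤1⇒unique t ∑t≤1 (suc i) (suc j) ti tj =
  cong suc (∑≤1⇒unique (t ∘ suc) (≤-trans (m≤n+m _ _) ∑t≤1) i j ti tj)

-- Independent sets of odd cycles

Next-functional : ∀ {ℓ} {i j j′ : Fin ℓ} → Next i j → Next i j′ → j ≡ j′
Next-functional (inj₁ p)       (inj₁ q)       = toℕ-injective (trans p (sym q))
Next-functional {j = j} (inj₁ p) (inj₂ (q , _)) = contradiction (trans p q) (<⇒≢ (toℕ<n j))
Next-functional {j′ = j′} (inj₂ (p , _)) (inj₁ q) = contradiction (trans q p) (<⇒≢ (toℕ<n j′))
Next-functional (inj₂ (_ , p)) (inj₂ (_ , q)) = toℕ-injective (trans p (sym q))

succ : ∀ {n} → Fin (suc n) → Fin (suc n)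
succ {n} i with n ≟ toℕ i
... | yes _   = zero
... | no  n≢i = suc (lower₁ i n≢i)

Next-succ : ∀ {n} (i : Fin (suc n)) → Next i (succ i)
Next-succ {n} i with n ≟ toℕ i
... | yes n≡i = inj₂ (cong suc (sym n≡i) , refl)
... | no  n≢i = inj₁ (cong suc (toℕ-lower₁ i n≢i))

succ-inject₁ : ∀ {n} (i : Fin n) → succ (inject₁ i) ≡ suc i
succ-inject₁ i = Next-functional (Next-succ (inject₁ i)) (inj₁ (cong suc (sym (toℕ-inject₁ i))))

succ-fromℕ : ∀ n → succ (fromℕ n) ≡ zero
succ-fromℕ n = Next-functional (Next-succ (fromℕ n)) (inj₂ (cong suc (toℕ-fromℕ n) , refl))

-- `succ` rotates the positions: the last term of the shifted sum is `t zero`, and the earlier ones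
-- run through the rest of `t`.
∑-succ : ∀ {n} (t : Fin (suc n) → ℕ) → ∑ (t ∘ succ) ≡ ∑ t
∑-succ {n} t = begin
  ∑ (t ∘ succ)                                   ≡⟨ sum-init-last +-0-commutativeMonoid (t ∘ succ) ⟩
  ∑ (t ∘ succ ∘ inject₁) + t (succ (fromℕ n))    ≡⟨ cong₂ _+_ (sum-cong-≗ +-0-commutativeMonoid (cong t ∘ succ-inject₁)) (cong t (succ-fromℕ n)) ⟩
  ∑ (t ∘ suc) + t zero                           ≡⟨ +-comm _ (t zero) ⟩
  ∑ t                                            ∎
  where open ≡-Reasoning

⟦_⟧ : Bool → ℕ
⟦ false ⟧ = 0
⟦ true  ⟧ = 1

Independent : ∀ {ℓ} → (Fin ℓ → Bool) → Set
Independent g = ∀ {i j} → Next i j → g i ∧ g j ≡ false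

uncovered+covered : ∀ a b → a ∧ b ≡ false → ⟦ not (a ∨ b) ⟧ + (⟦ a ⟧ + ⟦ b ⟧) ≡ 1
uncovered+covered false false _ = refl
uncovered+covered false true  _ = refl
uncovered+covered true  false _ = refl

module _ {n} (g : Fin (suc n) → Bool) (indep : Independent g) where

  uncovered : Fin (suc n) → ℕ
  uncovered i = ⟦ not (g i ∨ g (succ i)) ⟧

  -- With the edge from `i` to `succ i` indexed by `i`, `uncovered` counts edges. Each chosen vertex
  -- covers two edges, and independence prevents an edge from being covered twice.
  ∑uncovered : ∑ uncovered + 2 * ∑ (⟦_⟧ ∘ g) ≡ suc n
  ∑uncovered = begin
    ∑ uncovered + 2 * a                                       ≡⟨ cong (λ b → ∑ uncovered + (a + b)) (+-identityʳ a) ⟩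
    ∑ uncovered + (a + a)                                     ≡⟨ cong (λ b → ∑ uncovered + (a + b)) (∑-succ (⟦_⟧ ∘ g)) ⟨
    ∑ uncovered + (a + ∑ (⟦_⟧ ∘ g ∘ succ))                    ≡⟨ cong (∑ uncovered +_) (∑-distrib-+ +-0-commutativeMonoid (⟦_⟧ ∘ g) (⟦_⟧ ∘ g ∘ succ)) ⟨
    ∑ uncovered + ∑ (λ i → ⟦ g i ⟧ + ⟦ g (succ i) ⟧)          ≡⟨ ∑-distrib-+ +-0-commutativeMonoid uncovered (λ i → ⟦ g i ⟧ + ⟦ g (succ i) ⟧) ⟨
    ∑ (λ i → uncovered i + (⟦ g i ⟧ + ⟦ g (succ i) ⟧))        ≡⟨ ∑-const (λ i → uncovered+covered (g i) (g (succ i)) (indep (Next-succ i))) ⟩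
    suc n * 1                                                 ≡⟨ *-identityʳ (suc n) ⟩
    suc n                                                     ∎
    where
    open ≡-Reasoning
    a = ∑ (⟦_⟧ ∘ g)

2a≤1+2r⇒a≤r : ∀ a r → 2 * a ≤ suc (2 * r) → a ≤ r
2a≤1+2r⇒a≤r a r 2a≤1+2r with a ≤? r
... | yes a≤r = a≤r
... | no  a≰r = contradiction 2a≤1+2r (<⇒≱ (begin-strict
  suc (2 * r)   <⟨ n<1+n _ ⟩
  2 + 2 * r     ≡⟨ *-suc 2 r ⟨
  2 * suc r     ≤⟨ *-monoʳ-≤ 2 (≰⇒> a≰r) ⟩
  2 * a         ∎))
  where open ≤-Reasoning

independent-≤ : ∀ r (g : Fin (suc (2 * r)) → Bool) → Independent g → ∑ (⟦_⟧ ∘ g) ≤ r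
independent-≤ r g indep = 2a≤1+2r⇒a≤r _ r
  (≤-trans (m≤n+m _ (∑ (uncovered g indep))) (≤-reflexive (∑uncovered g indep)))

-- The `r` chosen vertices cover `2 * r` of the `suc (2 * r)` edges, so a single edge is left,
-- identified by its first end.
uncovered-edge-unique : ∀ r (g : Fin (suc (2 * r)) → Bool) → Independent g → ∑ (⟦_⟧ ∘ g) ≡ r →
  ∀ {i j i′ j′} → Next i j → Next i′ j′ →
  g i ≡ false → g j ≡ false → g i′ ≡ false → g j′ ≡ false → i ≡ i′
uncovered-edge-unique r g indep ∑g≡r {i} {i′ = i′} ij i′j′ gi gj gi′ gj′ =
  ∑≤1⇒unique (uncovered g indep) (≤-reflexive ∑≡1) i i′ (uncovered≡1 ij gi gj) (uncovered≡1 i′j′ gi′ gj′)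
  where
  ∑≡1 : ∑ (uncovered g indep) ≡ 1
  ∑≡1 = +-cancelʳ-≡ (2 * r) _ 1
    (trans (cong (λ a → ∑ (uncovered g indep) + 2 * a) (sym ∑g≡r)) (∑uncovered g indep))

  uncovered≡1 : ∀ {i j} → Next i j → g i ≡ false → g j ≡ false → uncovered g indep i ≡ 1
  uncovered≡1 {i} ij gi gj rewrite Next-functional (Next-succ i) ij | gi | gj = refl

-- Double counting along a cycle

∣p∣≡∑ : ∀ {n} (p : Subset n) → ∣ p ∣ ≡ ∑ (λ x → ⟦ lookup p x ⟧)
∣p∣≡∑ []          = refl
∣p∣≡∑ (true  ∷ p) = cong suc (∣p∣≡∑ p)
∣p∣≡∑ (false ∷ p) = ∣p∣≡∑ p

lookup-∧⇒disjoint : ∀ {n} (p q : Subset n) → (∀ x → lookup p x ∧ lookup q x ≡ false) → Empty (p ∩ q)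
lookup-∧⇒disjoint p q p∧q≡f (x , x∈p∩q)
  with () ← trans (sym (p∧q≡f x)) (trans (sym (lookup-zipWith _∧_ x p q)) ([]=⇒lookup x∈p∩q))

disjoint⇒lookup-∧ : ∀ {n} (p q : Subset n) → Empty (p ∩ q) → ∀ x → lookup p x ∧ lookup q x ≡ false
disjoint⇒lookup-∧ p q p∩q≡∅ x = Bool.¬-not λ eq →
  p∩q≡∅ (x , lookup⇒[]= x (p ∩ q) (trans (lookup-zipWith _∧_ x p q) eq))

module _ {n K} .{{_ : NonZero K}} {ℓ} (C : Cycle (KG n K) ℓ) where
  open Cycle C

  contains : Fin n → Fin ℓ → Bool
  contains x i = lookup (proj₁ (vertex i)) x

  contains-independent : ∀ x → Independent (contains x)
  contains-independent x ij = disjoint⇒lookup-∧ _ _ (edge ij) x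

  -- Exchanging the sums counts the incidences by position instead, where each set contributes `K`.
  double-count : ∑ (λ x → ∑ (⟦_⟧ ∘ contains x)) ≡ ℓ * K
  double-count = trans (∑-comm +-0-commutativeMonoid (λ x i → ⟦ contains x i ⟧))
    (∑-const λ i → trans (sym (∣p∣≡∑ (proj₁ (vertex i)))) (proj₂ (vertex i)))

odd-cycle-bound : ∀ {n K} .{{_ : NonZero K}} r → Cycle (KG n K) (suc (2 * r)) → suc (2 * r) * K ≤ n * r
odd-cycle-bound r C = ≤-trans (≤-reflexive (sym (double-count C)))
  (∑-bounded λ x → independent-≤ r (contains C x) (contains-independent C x))

-- The lexicographic orientation

_<ₗₑₓ_ : ∀ {n} → Subset n → Subset n → Set
_<ₗₑₓ_ = Lex-< _≡_ Bool._<_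

<ₗₑₓ-head-false : ∀ {n} {p q : Subset (suc n)} → p <ₗₑₓ q → lookup q zero ≡ false → lookup p zero ≡ false
<ₗₑₓ-head-false (this Bool.f<t _) ()
<ₗₑₓ-head-false (next refl _) q₀≡f = q₀≡f

lexOrientation : ∀ n K .{{_ : NonZero K}} → Orientation (KG n K)
lexOrientation n K = record
  { _⇒_      = λ u v → u ~ v × proj₁ v <ₗₑₓ proj₁ u
  ; _⇒?_     = λ u v → ¬? (nonempty? _) ×-dec <-decidable Bool._≟_ Bool._<?_ (proj₁ v) (proj₁ u)
  ; arc⇒edge = proj₁
  ; edge⇒arc = λ {u} {v} u~v → orient u v u~v
  ; ⇒-asym   = λ { (_ , v<u) (_ , u<v) → <-asym sym Bool.<-resp₂-≡ Bool.<-asym v<u u<v }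
  }
  where
  open SimpleGraph (KG n K)
  orient : ∀ u v → u ~ v → (u ~ v × proj₁ v <ₗₑₓ proj₁ u) ⊎ (v ~ u × proj₁ u <ₗₑₓ proj₁ v)
  orient u@(p , ∣p∣) v@(q , ∣q∣) u~v with <-cmp sym Bool.<-cmp p q
  ... | tri< p<q _ _ = inj₂ (~-sym {u} {v} u~v , p<q)
  ... | tri> _ _ q<p = inj₁ (u~v , q<p)
  -- Equal subsets are equal vertices because cardinality proofs are irrelevant, and no vertex is
  -- adjacent to itself.
  ... | tri≈ _ p≋q _ with refl ← Pointwise-≡⇒≡ p≋q =
    contradiction u~v (~-irrefl {u} {v} (cong (p ,_) (≡-irrelevant ∣p∣ ∣q∣)))

filter-witness : ∀ {A : Set} {P : A → Set} (P? : Decidable P) xs → 0 < length (filter P? xs) → ∃ P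
filter-witness P? (x ∷ xs) 0< with P? x
... | yes px = x , px
... | no  _  = filter-witness P? xs 0<

-- The second equation is the equality case of `odd-cycle-bound`. The length `ℓ` is a variable
-- because `2 * k + 1` is not definitionally `suc (2 * k)`.
lexOrientation-alternating : ∀ n K .{{_ : NonZero K}} r ℓ → ℓ ≡ suc (2 * r) → suc (2 * r) * K ≡ n * r →
  (C : Cycle (KG n K) ℓ) → Alternating (lexOrientation n K) C
lexOrientation-alternating zero K r ℓ refl count C =
  contradiction (m*n≡0⇒m≡0 (suc (2 * r)) K count) λ ()
lexOrientation-alternating (suc n) K r ℓ refl count C i i′ (in-i , out-i) (in-i′ , out-i′) =
  compare (transit in-i out-i) (transit in-i′ out-i′)
  where
  open Cycle C
  open Orientation (lexOrientation (suc n) K)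

  g : Fin ℓ → Bool
  g = contains C zero

  ∑g≡r : ∑ (⟦_⟧ ∘ g) ≡ r
  ∑g≡r = ∑-bounded-tight (λ x → independent-≤ r (contains C x) (contains-independent C x))
    (trans (double-count C) count)

  unique : ∀ {i j i′ j′} → Next i j → Next i′ j′ →
    g i ≡ false → g j ≡ false → g i′ ≡ false → g j′ ≡ false → i ≡ i′
  unique = uncovered-edge-unique r g (contains-independent C zero) ∑g≡r

  UncoveredOut : Fin ℓ → Set
  UncoveredOut i = ∃ λ j → CyclicallyAdjacent i j × vertex i ⇒ vertex j × g i ≡ false × g j ≡ false

  -- A tail with the first element is disjoint from the head; a tail without it is lexicographically
  -- larger than the head, which then lacks it too.
  head-of-arc : ∀ {i j} → vertex j ⇒ vertex i → g i ≡ false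
  head-of-arc {i} {j} (j~i , i<j) with g j in gj
  ... | false = <ₗₑₓ-head-false i<j gj
  ... | true  = trans (cong (_∧ g i) (sym gj)) (disjoint⇒lookup-∧ _ _ j~i zero)

  transit : ∀ {i} → 0 < inDegree (lexOrientation (suc n) K) C i →
    0 < outDegree (lexOrientation (suc n) K) C i → UncoveredOut i
  transit {i} in-i out-i
    with filter-witness (λ j → cyclicallyAdjacent? i j ×-dec (vertex j ⇒? vertex i)) (allFin ℓ) in-i
       | filter-witness (λ j → cyclicallyAdjacent? i j ×-dec (vertex i ⇒? vertex j)) (allFin ℓ) out-i
  -- The incoming arc makes `i` a head and the outgoing one makes `j` a head, so the edge between
  -- `i` and `j` avoids the first element.
  ... | h , _ , h⇒i | j , ij , i⇒j = j , ij , i⇒j , head-of-arc {j = h} h⇒i , head-of-arc i⇒j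

  compare : ∀ {i i′} → UncoveredOut i → UncoveredOut i′ → i ≡ i′
  compare (j , inj₁ ij , _ , gi , gj) (j′ , inj₁ i′j′ , _ , gi′ , gj′) = unique ij i′j′ gi gj gi′ gj′
  compare (j , inj₂ ji , _ , gi , gj) (j′ , inj₂ j′i′ , _ , gi′ , gj′)
    with refl ← unique ji j′i′ gj gi gj′ gi′ = Next-functional ji j′i′
  -- Both outgoing arcs lie on the same edge; leaving in opposite senses around the cycle would
  -- orient it both ways.
  compare (j , inj₁ ij , i⇒j , gi , gj) (j′ , inj₂ j′i′ , i′⇒j′ , gi′ , gj′)
    with refl ← unique ij j′i′ gi gj gj′ gi′
    with refl ← Next-functional ij j′i′ = contradiction i′⇒j′ (⇒-asym {vertex _} {vertex _} i⇒j)
  compare (j , inj₂ ji , i⇒j , gi , gj) (j′ , inj₁ i′j′ , i′⇒j′ , gi′ , gj′)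
    with refl ← unique ji i′j′ gj gi gi′ gj′
    with refl ← Next-functional ji i′j′ = contradiction i′⇒j′ (⇒-asym {vertex _} {vertex _} i⇒j)

-- A cycle of length 2k + 1

odd : ℕ → Bool
odd 0             = false
odd 1             = true
odd (suc (suc n)) = odd n

odd-suc : ∀ n → odd (suc n) ≡ not (odd n)
odd-suc 0             = refl
odd-suc 1             = refl
odd-suc (suc (suc n)) = odd-suc n

-- bit i j holds iff j < i and i − j is even, or j > i and j − i is odd; that is,
-- iff i − j mod 2k + 1 is one of 2, 4, …, 2k, for i, j ≤ 2k.
bit : ℕ → ℕ → Bool
bit zero    j       = odd j
bit (suc i) zero    = odd i
bit (suc i) (suc j) = bit i j

bit-diag : ∀ i → bit i i ≡ false
bit-diag zero    = refl
bit-diag (suc i) = bit-diag i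

-- For distinct arguments, `bit` asks for an even gap in one order and an odd gap in the other.
bit-swap : ∀ i j → i ≢ j → bit j i ≡ not (bit i j)
bit-swap zero    zero    i≢j = contradiction refl i≢j
bit-swap zero    (suc j) i≢j = trans (sym (Bool.not-involutive _)) (cong not (sym (odd-suc j)))
bit-swap (suc i) zero    i≢j = odd-suc i
bit-swap (suc i) (suc j) i≢j = bit-swap i j (i≢j ∘ cong suc)

-- Going from `i` to `suc i` flips the parity of the gap while `j` stays on the same side; otherwise
-- `j` is `i` or `suc i`, and a diagonal entry is false.
bit-∧-suc : ∀ i j → bit i j ∧ bit (suc i) j ≡ false
bit-∧-suc zero    zero    = refl
bit-∧-suc zero    (suc j) rewrite odd-suc j = Bool.∧-inverseˡ (odd j)
bit-∧-suc (suc i) zero    rewrite odd-suc i = Bool.∧-inverseʳ (odd i)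
bit-∧-suc (suc i) (suc j) = bit-∧-suc i j

-- Here `odd j` is `bit 0 j`, so this serves the edge from the last row back to row 0: for even `i`
-- and odd `j`, the gap `i − j` is odd.
bit-∧-wrap : ∀ i j → j ≤ i → odd i ≡ false → bit i j ∧ odd j ≡ false
bit-∧-wrap i zero j≤i oi = Bool.∧-zeroʳ (bit i 0)
bit-∧-wrap (suc zero) (suc zero) j≤i ()
bit-∧-wrap (suc (suc i)) (suc zero) j≤i oi rewrite oi = refl
bit-∧-wrap (suc (suc i)) (suc (suc j)) (s≤s (s≤s j≤i)) oi = bit-∧-wrap i j j≤i oi

row : ∀ n → ℕ → Subset n
row n i = tabulate (bit i ∘ toℕ)

-- The form `k * 2` unfolds by two successors at a time, in step with the recursion of `odd`.
∣odd∣-even : ∀ k → ∣ row (k * 2) 0 ∣ ≡ k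
∣odd∣-even zero    = refl
∣odd∣-even (suc k) = cong suc (∣odd∣-even k)

∣odd∣-odd : ∀ k → ∣ row (suc (k * 2)) 0 ∣ ≡ k
∣odd∣-odd zero    = refl
∣odd∣-odd (suc k) = cong suc (∣odd∣-odd k)

∣row∣ : ∀ k {n} i → n ≡ suc (k * 2) → i < n → ∣ row n i ∣ ≡ k
∣row∣ k zero refl _ = ∣odd∣-odd k
∣row∣ k (suc zero) refl _ = ∣odd∣-even k
∣row∣ zero (suc (suc i)) refl (s≤s ())
-- The first two entries are `odd (suc i)` and `odd i`, exactly one of them true; deleting both
-- leaves row `i`, shorter by two.
∣row∣ (suc k) (suc (suc i)) refl (s≤s (s≤s i<n)) with ∣row∣ k i refl i<n
... | ih rewrite odd-suc i with odd i
...   | false = cong suc ih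
...   | true  = cong suc ih

-- Repeating a subset in `m` blocks carries a cycle of KG(2k+1, k) into KG(m(2k+1), mk).
copies : ∀ m {n} → Subset n → Subset (m * n)
copies m p = concat (replicate m p)

∣++∣ : ∀ {m n} (p : Subset m) (q : Subset n) → ∣ p ++ q ∣ ≡ ∣ p ∣ + ∣ q ∣
∣++∣ []          q = refl
∣++∣ (true  ∷ p) q = cong suc (∣++∣ p q)
∣++∣ (false ∷ p) q = ∣++∣ p q

∣copies∣ : ∀ m {n} (p : Subset n) → ∣ copies m p ∣ ≡ m * ∣ p ∣
∣copies∣ zero    p = refl
∣copies∣ (suc m) p = trans (∣++∣ p (copies m p)) (cong (∣ p ∣ +_) (∣copies∣ m p))

lookup-copies : ∀ m {n} (p : Subset n) i j → lookup (copies m p) (combine i j) ≡ lookup p j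
lookup-copies m p i j = trans (lookup-concat (replicate m p) i j) (cong (λ q → lookup q j) (lookup-replicate i p))

copies-disjoint : ∀ m {n} (p q : Subset n) → (∀ x → lookup p x ∧ lookup q x ≡ false) → Empty (copies m p ∩ copies m q)
copies-disjoint m {n} p q p∧q≡f = lookup-∧⇒disjoint _ _ λ x → aux (combine-surjective {m} {n} x)
  where
  aux : ∀ {x} → (∃ λ i → ∃ λ j → combine {m} {n} i j ≡ x) → lookup (copies m p) x ∧ lookup (copies m q) x ≡ false
  aux (i , j , refl) = trans (cong₂ _∧_ (lookup-copies m p i j) (lookup-copies m q i j)) (p∧q≡f j)

copies-injective : ∀ m .{{_ : NonZero m}} {n} {p q : Subset n} → copies m p ≡ copies m q → p ≡ q
copies-injective (suc m) {p = p} {q} eq = ++-injectiveˡ p q eq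

row-lookup : ∀ {n} i (j : Fin n) → lookup (row n i) j ≡ bit i (toℕ j)
row-lookup i j = lookup∘tabulate (bit i ∘ toℕ) j

-- Diagonal entries are false, so equal rows would make both `bit i j` and `bit j i` false, against
-- `bit-swap`.
row-injective : ∀ {n} (i j : Fin n) → row n (toℕ i) ≡ row n (toℕ j) → toℕ i ≡ toℕ j
row-injective {n} i j eq with toℕ i ≟ toℕ j
... | yes i≡j = i≡j
... | no  i≢j = contradiction (trans (sym ji≡f) (trans (bit-swap (toℕ i) (toℕ j) i≢j) (cong not ij≡f))) λ ()
  where
  same : ∀ x → bit (toℕ i) (toℕ x) ≡ bit (toℕ j) (toℕ x)
  same x = trans (sym (row-lookup (toℕ i) x)) (trans (cong (λ p → lookup p x) eq) (row-lookup (toℕ j) x))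
  ij≡f = trans (same j) (bit-diag (toℕ j))
  ji≡f = trans (sym (same i)) (bit-diag (toℕ i))

odd-double : ∀ k → odd (k * 2) ≡ false
odd-double zero    = refl
odd-double (suc k) = odd-double k

row-disjoint : ∀ k {n} → n ≡ suc (k * 2) → {i j : Fin n} → Next i j →
  ∀ x → lookup (row n (toℕ i)) x ∧ lookup (row n (toℕ j)) x ≡ false
row-disjoint k refl {i} {j} ij x =
  trans (cong₂ _∧_ (row-lookup (toℕ i) x) (row-lookup (toℕ j) x)) (aux ij)
  where
  aux : Next i j → bit (toℕ i) (toℕ x) ∧ bit (toℕ j) (toℕ x) ≡ false
  aux (inj₁ j≡1+i) rewrite j≡1+i = bit-∧-suc (toℕ i) (toℕ x)
  aux (inj₂ (1+i≡n , j≡0)) rewrite suc-injective 1+i≡n | j≡0 =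
    bit-∧-wrap (k * 2) (toℕ x) (toℕ≤pred[n] x) (odd-double k)

2k+1≡1+k*2 : ∀ k → 2 * k + 1 ≡ suc (k * 2)
2k+1≡1+k*2 = solve-∀

oddCycle : ∀ m k .{{_ : NonZero m}} .{{_ : NonZero k}} →
  Cycle (KG (m * (2 * k + 1)) (m * k) {{m*n≢0 m k}}) (2 * k + 1)
oddCycle m k = record
  { 3≤ℓ              = +-monoˡ-≤ 1 (*-monoʳ-≤ 2 (n≢0⇒n>0 (≢-nonZero⁻¹ k)))
  ; vertex           = λ i → copies m (row _ (toℕ i)) ,
      trans (∣copies∣ m (row _ (toℕ i))) (cong (m *_) (∣row∣ k (toℕ i) (2k+1≡1+k*2 k) (toℕ<n i)))
  ; vertex-injective = λ {i} {j} eq → toℕ-injective (row-injective i j (copies-injective m (cong proj₁ eq)))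
  ; edge             = λ ij → copies-disjoint m _ _ (row-disjoint k (2k+1≡1+k*2 k) ij)
  }

-- The odd girth, and the tight case of the count

2∤2k+1 : ∀ k → 2 ∤ (2 * k + 1)
2∤2k+1 k 2∣ = contradiction (∣⇒≤ (∣m+n∣m⇒∣n 2∣ (m∣m*n k))) λ { (s≤s ()) }

2∤⇒odd : ∀ ℓ → 2 ∤ ℓ → ∃ λ r → ℓ ≡ suc (2 * r)
2∤⇒odd zero          2∤ℓ = contradiction (divides 0 refl) 2∤ℓ
2∤⇒odd (suc zero)    2∤ℓ = 0 , refl
2∤⇒odd (suc (suc ℓ)) 2∤ℓ with 2∤⇒odd ℓ (2∤ℓ ∘ ∣m∣n⇒∣m+n ∣-refl)
... | r , refl = suc r , cong suc (sym (*-suc 2 r))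

-- Removing the common term `2 * (m * k * r)` leaves `m * k ≤ m * r`.
oddGirth-bound : ∀ m k r .{{_ : NonZero m}} → suc (2 * r) * (m * k) ≤ (m * (2 * k + 1)) * r → k ≤ r
oddGirth-bound m k r bound = *-cancelˡ-≤ m (+-cancelˡ-≤ (2 * (m * k * r)) _ _ (begin
  2 * (m * k * r) + m * k    ≡⟨ lhs m k r ⟩
  suc (2 * r) * (m * k)      ≤⟨ bound ⟩
  (m * (2 * k + 1)) * r      ≡⟨ rhs m k r ⟩
  2 * (m * k * r) + m * r    ∎))
  where
  open ≤-Reasoning
  lhs : ∀ m k r → 2 * (m * k * r) + m * k ≡ suc (2 * r) * (m * k)
  lhs = solve-∀
  rhs : ∀ m k r → (m * (2 * k + 1)) * r ≡ 2 * (m * k * r) + m * r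
  rhs = solve-∀

mainTheorem14 : (m k : ℕ) .{{_ : NonZero m}} .{{_ : NonZero k}} →
    let G = KG (m * (2 * k + 1)) (m * k) {{m*n≢0 m k}} in
    HasOddGirth G (2 * k + 1) ×
    Σ (Orientation G) (λ O → (C : Cycle G (2 * k + 1)) → Alternating O C)
mainTheorem14 m k =
  (2∤2k+1 k , oddCycle m k , λ ℓ 2∤ℓ → minimal (2∤⇒odd ℓ 2∤ℓ)) ,
  lexOrientation _ _ {{m*n≢0 m k}} ,
  -- At `r = k` the double-counting bound becomes the equality `count`.
  lexOrientation-alternating _ _ {{m*n≢0 m k}} k _ (+-comm (2 * k) 1) (count m k)
  where
  minimal : ∀ {ℓ} → (∃ λ r → ℓ ≡ suc (2 * r)) →
    Cycle (KG (m * (2 * k + 1)) (m * k) {{m*n≢0 m k}}) ℓ → 2 * k + 1 ≤ ℓ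
  minimal (r , refl) C = ≤-trans (≤-reflexive (+-comm (2 * k) 1))
    (s≤s (*-monoʳ-≤ 2 (oddGirth-bound m k r (odd-cycle-bound {{m*n≢0 m k}} r C))))

  count : ∀ m k → suc (2 * k) * (m * k) ≡ m * (2 * k + 1) * k
  count = solve-∀
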